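{- A countably infinite graph $G$ is ME-homogeneous if and only if it is HE-homogeneous.
   Context: All graphs are undirected and loopless; $\sim$ denotes adjacency, and all subgraphs are induced. A homomorphism maps adjacent vertices to adjacent vertices; a monomorphism is an injective homomorphism. A countable graph $G$ is ME-homogeneous (resp. HE-homogeneous) if every monomorphism (resp. every homomorphism) between finite induced subgraphs of $G$ is the restriction of a surjective endomorphism $G\to G$. -}

module Defs where

open import Level using (0ℓ)
open import Data.Fin using (Fin)
open import Data.Nat using (ℕ)
open import Data.Product using (_×_; ∃-syntax)
open import Function.Bundles using (_↣_; _⤖_; module Injection)
open import Function.Definitions using (Injective; Surjective)
open import Relation.Binary.Core using (Rel)
open import Relation.Binary.Definitions using (Symmetric; Irreflexive)
open import Relation.Binary.Morphism.Structures using (IsRelHomomorphism)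
open import Relation.Binary.PropositionalEquality using (_≡_; cong)

record Graph : Set₁ where
  field
    Vertex : Set
    _∼_    : Rel Vertex 0ℓ
    ∼-sym    : Symmetric _∼_
    ∼-irrefl : Irreflexive _≡_ _∼_

open Graph using (Vertex)

CountablyInfinite : Graph → Set
CountablyInfinite G = ℕ ⤖ Vertex G

IsHomomorphism : (G H : Graph) → (Vertex G → Vertex H) → Set
IsHomomorphism G H = IsRelHomomorphism (Graph._∼_ G) (Graph._∼_ H)

-- The library's IsRelMonomorphism is stronger: its injectivity is relative
-- to the relations, so it demands that adjacency also be reflected.
IsMonomorphism : (G H : Graph) → (Vertex G → Vertex H) → Set
IsMonomorphism G H f = IsHomomorphism G H f × Injective _≡_ _≡_ f

IsSurjectiveEndomorphism : (G : Graph) → (Vertex G → Vertex G) → Set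
IsSurjectiveEndomorphism G F = IsHomomorphism G G F × Surjective _≡_ _≡_ F

-- A finite set of vertices is given by an enumeration without repetition;
-- the subgraph it induces is carried by the index set, and `embed` is the
-- inclusion into G.
record FiniteInducedSubgraph (G : Graph) : Set where
  field
    size        : ℕ
    enumeration : Fin size ↣ Vertex G

  embed : Fin size → Vertex G
  embed = Injection.to enumeration

  graph : Graph
  graph = record
    { Vertex   = Fin size
    ; _∼_      = λ i j → Graph._∼_ G (embed i) (embed j)
    ; ∼-sym    = Graph.∼-sym G
    ; ∼-irrefl = λ i≡j → Graph.∼-irrefl G (cong embed i≡j)
    }

open FiniteInducedSubgraph using (graph; embed)

IsRestrictionOfSurjectiveEndomorphism :
  (G : Graph) (A B : FiniteInducedSubgraph G) →
  (Vertex (graph A) → Vertex (graph B)) → Set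
IsRestrictionOfSurjectiveEndomorphism G A B f =
  ∃[ F ] (IsSurjectiveEndomorphism G F ×
          (∀ i → F (embed A i) ≡ embed B (f i)))

ME-Homogeneous : Graph → Set
ME-Homogeneous G =
  (A B : FiniteInducedSubgraph G) (f : Vertex (graph A) → Vertex (graph B)) →
  IsMonomorphism (graph A) (graph B) f →
  IsRestrictionOfSurjectiveEndomorphism G A B f

HE-Homogeneous : Graph → Set
HE-Homogeneous G =
  (A B : FiniteInducedSubgraph G) (f : Vertex (graph A) → Vertex (graph B)) →
  IsHomomorphism (graph A) (graph B) f →
  IsRestrictionOfSurjectiveEndomorphism G A B f

{-# OPTIONS --safe #-}
module Submission where

open import Level using (0ℓ)
open import Axiom.ExcludedMiddle using (ExcludedMiddle)
open import Function.Bundles using (_⇔_; mk⇔; mk↣; module Bijection; module Injection)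
open import Function.Base using (_∘_; id)
open import Data.Empty using (⊥; ⊥-elim)
open import Data.Fin.Base using (Fin; zero; suc; toℕ; fromℕ<)
open import Data.Fin.Properties using (injective⇒≤; toℕ-injective; toℕ<n; toℕ-fromℕ<)
open import Data.List.Base
  using (List; []; _∷_; [_]; _++_; length; lookup; map; concat; filter; deduplicate; replicate; tabulate)
open import Data.List.Properties 
  using (filter-notAll; concat-map-[_]; length-map; length-replicate; length-++; ++-identityʳ)
open import Data.List.Membership.Propositional using (_∈_; _∉_)
open import Data.List.Membership.Propositional.Properties
open import Data.List.Relation.Binary.Pointwise using (Pointwise; []; _∷_)
open import Data.List.Relation.Unary.All as All using (All; []; _∷_)
import Data.List.Relation.Unary.All.Properties as All
open import Data.List.Relation.Unary.AllPairs as AllPairs using (AllPairs; []; _∷_)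
import Data.List.Relation.Unary.AllPairs.Properties as AllPairs
open import Data.List.Relation.Unary.Any as Any using (here; there; index)
open import Data.List.Relation.Unary.Any.Properties using (lookup-index)
open import Data.List.Relation.Unary.Unique.Propositional using (Unique)
import Data.List.Relation.Unary.Unique.Propositional.Properties as Unique
open import Data.List.Relation.Unary.Unique.DecPropositional.Properties using (deduplicate-!)
open import Data.Nat.Base
  using (ℕ; zero; suc; _+_; _*_; _≤_; _<_; _≤′_; ≤′-refl; ≤′-step; z≤n; s≤s; _⊔_)
import Data.Nat.Properties as ℕ
open import Data.Product using (Σ; ∃-syntax; _×_; _,_; proj₁; proj₂)
open import Data.Sum using (_⊎_; inj₁; inj₂)
open import Relation.Binary.Definitions using (Symmetric)
open import Relation.Binary.Morphism.Structures using (module IsRelHomomorphism)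
open import Relation.Binary.PropositionalEquality using (_≡_; _≢_; refl; sym; trans; cong; subst)
open import Relation.Nullary using (¬_; Dec; yes; no; contradiction; ¬?)
open import Defs

-- A cone (cocone) of a finite set S is a vertex outside S adjacent to all (none)
-- of S.  Images of coned sets under finite monomorphisms are coned and, by
-- surjectivity, preimages of coconed sets are coconed.  A back-and-forth
-- construction gives HE-homogeneity once, for every finite epimorphism A → B,
-- the image of a coned part is coned (pass to a transversal of the fibres) and
-- A has a cocone whenever B has.  The latter can only fail if some finite set
-- has no cocone.  Then let k be the largest size of a clique with a cocone.  If
-- k = 0 or k = 1, the graph is complete or every stable set has a cocone, and
-- the claim follows.  If k ≥ 2, every finite set is joined to arbitrarily large
-- independent sets and every bipartite set has a cocone; taking the least r
-- such that some r-partite finite set has no cocone, a blow-up of an induced P₄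
-- yields a large complete r-partite set with a cocone, which is absurd.

-- Finite lists and classical search.

module _ {A : Set} where

  length≡suc⇒∈ : {xs : List A} {n : ℕ} → length xs ≡ suc n → ∃[ x ] x ∈ xs
  length≡suc⇒∈ {x ∷ _} _ = x , here refl

  lookup-injective : {xs : List A} → Unique xs → ∀ {i j} → lookup xs i ≡ lookup xs j → i ≡ j
  lookup-injective (_ ∷ _) {zero} {zero} _ = refl
  lookup-injective (x∉ ∷ _) {zero} {suc j} e = contradiction e (All.lookup x∉ (∈-lookup j))
  lookup-injective (x∉ ∷ _) {suc i} {zero} e = contradiction (sym e) (All.lookup x∉ (∈-lookup i))
  lookup-injective (_ ∷ u) {suc i} {suc j} e = cong suc (lookup-injective u e)

  Unique-⊆⇒length≤ : {xs ys : List A} → Unique xs → (∀ {x} → x ∈ xs → x ∈ ys) → length xs ≤ length ys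
  Unique-⊆⇒length≤ {xs} {ys} u xs⊆ys = injective⇒≤ {f = λ i → index (xs⊆ys (∈-lookup i))} inj
    where
    inj : ∀ {i j} → index (xs⊆ys (∈-lookup i)) ≡ index (xs⊆ys (∈-lookup j)) → i ≡ j
    inj {i} {j} e = lookup-injective u
      (trans (lookup-index (xs⊆ys (∈-lookup i)))
        (trans (cong (lookup ys) e) (sym (lookup-index (xs⊆ys (∈-lookup j))))))

  length-filter-∁ : {P : A → Set} (P? : ∀ x → Dec (P x)) (xs : List A) →
    length xs ≡ length (filter P? xs) + length (filter (¬? ∘ P?) xs)
  length-filter-∁ P? [] = refl
  length-filter-∁ P? (x ∷ xs) with P? x
  ... | yes _ = cong suc (length-filter-∁ P? xs)
  ... | no _  = trans (cong suc (length-filter-∁ P? xs)) (sym (ℕ.+-suc _ _))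

module _ {A B : Set} {R : A → B → Set} {X : List A} {Y : List B} where

  all² : (∀ {x y} → x ∈ X → y ∈ Y → R x y) → All (λ x → All (R x) Y) X
  all² f = All.tabulate λ x∈ → All.tabulate (f x∈)

  lookup² : All (λ x → All (R x) Y) X → ∀ {x y} → x ∈ X → y ∈ Y → R x y
  lookup² r x∈ y∈ = All.lookup (All.lookup r x∈) y∈

-- Searching downwards from the failure at `n` meets a success at 0 at the latest.
last-success : ExcludedMiddle 0ℓ → (P : ℕ → Set) → P 0 → ∀ n → ¬ P n → ∃[ m ] (P m × ¬ P (suc m))
last-success em P p0 zero ¬p = contradiction p0 ¬p
last-success em P p0 (suc n) ¬p with em {P n}
... | yes p = n , p , ¬p
... | no ¬pn = last-success em P p0 n ¬pn

∃-of-¬∀ : ExcludedMiddle 0ℓ → {A : Set} {P : A → Set} → ¬ (∀ x → P x) → ∃[ x ] ¬ P x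
∃-of-¬∀ em {P = P} ¬∀ with em {∃[ x ] ¬ P x}
... | yes e = e
... | no ¬e = contradiction (λ x → decide x em) ¬∀
  where
  decide : ∀ x → Dec (P x) → P x
  decide x (yes p) = p
  decide x (no ¬p) = contradiction (x , ¬p) ¬e

-- Cones, cocones and the extension of finite monomorphisms.

module MEGraph (em : ExcludedMiddle 0ℓ) (G : Graph) (count : CountablyInfinite G) (me : ME-Homogeneous G) where

  open Graph G renaming (Vertex to V)
  open Bijection count using () renaming (to to enum; injective to enum-injective; surjective to enum-surjective)

  lem : (P : Set) → Dec P
  lem P = em

  infix 4 _⊥ᵥ_

  _⊥ᵥ_ : V → V → Set
  x ⊥ᵥ y = x ≢ y × ¬ (x ∼ y)

  ⊥-sym : ∀ {x y} → x ⊥ᵥ y → y ⊥ᵥ x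
  ⊥-sym (n , a) = n ∘ sym , a ∘ ∼-sym

  ∼⇒≢ : ∀ {x y} → x ∼ y → x ≢ y
  ∼⇒≢ a refl = ∼-irrefl refl a

  ∼-or-⊥ : ∀ {x y} → x ≢ y → x ∼ y ⊎ x ⊥ᵥ y
  ∼-or-⊥ {x} {y} x≢y with lem (x ∼ y)
  ... | yes a = inj₁ a
  ... | no ¬a = inj₂ (x≢y , ¬a)

  _≟ᵥ_ : (x y : V) → Dec (x ≡ y)
  x ≟ᵥ y = em

  nub : List V → List V
  nub = deduplicate _≟ᵥ_

  fresh : ∀ X → ∃[ v ] v ∉ X
  fresh X with ∃-of-¬∀ em (finite (mk↣ enum-injective) X)
  ... | i , ∉X = enum i , ∉X

  Cone Cocone : V → List V → Set
  Cone v X = All (v ∼_) X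
  Cocone v X = All (v ⊥ᵥ_) X

  Coned Coconed : List V → Set
  Coned X = ∃[ v ] Cone v X
  Coconed X = ∃[ v ] Cocone v X

  -- A finite monomorphism is presented as a relation, which may offer several images for one
  -- vertex; `extend` chooses among them.
  Faithful : (V → V → Set) → Set
  Faithful M = ∀ {x y x′ y′} → M x y → M x′ y′ → (y ≡ y′ → x ≡ x′) × (x ∼ x′ → y ∼ y′)

  extend : (X : List V) (M : V → V → Set) → (∀ {x} → x ∈ X → ∃[ y ] M x y) → Faithful M →
           ∃[ F ] (IsSurjectiveEndomorphism G F × (∀ {x} → x ∈ X → M x (F x)))
  extend X M total faithful = F , surj , agree
    where
    U : List V
    U = nub X
    im : ∀ i → ∃[ y ] M (lookup U i) y
    im i = total (∈-deduplicate⁻ _≟ᵥ_ X (∈-lookup i))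
    A B : FiniteInducedSubgraph G
    A = record { size = length U ; enumeration = mk↣ (lookup-injective (deduplicate-! _≟ᵥ_ X)) }
    B = record { size = length U ; enumeration = mk↣ {to = proj₁ ∘ im}
          (λ {i} {j} e → lookup-injective (deduplicate-! _≟ᵥ_ X) (proj₁ (faithful (proj₂ (im i)) (proj₂ (im j))) e)) }
    -- Both subgraphs are indexed by the positions in `U`, so the monomorphism between them is the
    -- identity on indices.
    ext : IsRestrictionOfSurjectiveEndomorphism G A B id
    ext = me A B id
      (record { cong = λ {i} {j} → proj₂ (faithful (proj₂ (im i)) (proj₂ (im j))) } , id)
    F : V → V
    F = proj₁ ext
    surj : IsSurjectiveEndomorphism G F
    surj = proj₁ (proj₂ ext)
    agree : ∀ {x} → x ∈ X → M x (F x)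
    agree x∈ = subst (λ z → M z (F z)) (sym (lookup-index x∈U))
      (subst (M _) (sym (proj₂ (proj₂ ext) (index x∈U))) (proj₂ (im (index x∈U))))
      where x∈U = ∈-deduplicate⁺ _≟ᵥ_ x∈

  module _ {F : V → V} (surj : IsSurjectiveEndomorphism G F) where

    F-hom : ∀ {x y} → x ∼ y → F x ∼ F y
    F-hom = IsRelHomomorphism.cong (proj₁ surj)

    preimage : ∀ y → ∃[ x ] F x ≡ y
    preimage y with proj₂ surj y
    ... | x , eq = x , eq refl

  -- A preimage of the cocone works: being equal or adjacent to some x in `X` would make its image
  -- equal or adjacent to the image of x in `Y`.
  pull-cocone : (X Y : List V) (M : V → V → Set) → (∀ {x} → x ∈ X → ∃[ y ] M x y) →
    (∀ {x y} → M x y → y ∈ Y) → Faithful M → Coconed Y → Coconed X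
  pull-cocone X Y M total target faithful (w , w⊥Y) with extend X M total faithful
  ... | F , surj , agree with preimage surj w
  ... | v , refl = v , All.tabulate λ x∈ →
      let Fv⊥Fx = All.lookup w⊥Y (target (agree x∈)) in
      (λ v≡x → proj₁ Fv⊥Fx (cong F v≡x)) , (λ a → proj₂ Fv⊥Fx (F-hom surj a))

  -- An endomorphism fixing S pointwise and moving one cocone off the finite
  -- set of all cocones would map that set, minus a point, onto itself.
  cocone-avoiding : ∀ {S} → Coconed S → ∀ X → ∃[ v ] (Cocone v S × v ∉ X)
  cocone-avoiding {S} (c , c⊥S) X with lem (∃[ v ] (Cocone v S × v ∉ X))
  ... | yes p = p
  ... | no none = ⊥-elim (ℕ.<-irrefl refl (ℕ.<-≤-trans smaller (ℕ.≤-trans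
          (Unique-⊆⇒length≤ D! covered) (ℕ.≤-reflexive (length-map F D′)))))
    where
    all∈X : ∀ {v} → Cocone v S → v ∈ X
    all∈X {v} v⊥S with lem (v ∈ X)
    ... | yes p = p
    ... | no ∉X = contradiction (v , v⊥S , ∉X) none
    c′ : V
    c′ = proj₁ (fresh (S ++ X))
    c′∉ : c′ ∉ S ++ X
    c′∉ = proj₂ (fresh (S ++ X))
    M : V → V → Set
    M x y = (x ≡ y × x ∈ S) ⊎ (x ≡ c × y ≡ c′)
    total : ∀ {x} → x ∈ c ∷ S → ∃[ y ] M x y
    total (here refl) = c′ , inj₂ (refl , refl)
    total (there x∈) = _ , inj₁ (refl , x∈)
    faithful : Faithful M
    faithful (inj₁ (refl , _)) (inj₁ (refl , _)) = id , id
    faithful (inj₁ (refl , x∈)) (inj₂ (refl , refl)) =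
      (λ { refl → contradiction (∈-++⁺ˡ x∈) c′∉ }) , λ a → contradiction (∼-sym a) (proj₂ (All.lookup c⊥S x∈))
    faithful (inj₂ (refl , refl)) (inj₁ (refl , x∈)) =
      (λ { refl → contradiction (∈-++⁺ˡ x∈) c′∉ }) , λ a → contradiction a (proj₂ (All.lookup c⊥S x∈))
    faithful (inj₂ (refl , refl)) (inj₂ (refl , refl)) = (λ _ → refl) , λ a → contradiction a (∼-irrefl refl)
    ext = extend (c ∷ S) M total faithful
    F = proj₁ ext
    surj = proj₁ (proj₂ ext)
    F-fixes : ∀ {s} → s ∈ S → F s ≡ s
    F-fixes s∈ with proj₂ (proj₂ ext) (there s∈)
    ... | inj₁ (e , _) = sym e
    ... | inj₂ (refl , _) = contradiction refl (proj₁ (All.lookup c⊥S s∈))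
    Fc≡c′ : F c ≡ c′
    Fc≡c′ with proj₂ (proj₂ ext) (here refl)
    ... | inj₁ (_ , c∈) = contradiction refl (proj₁ (All.lookup c⊥S c∈))
    ... | inj₂ (_ , e) = e
    cocone? : ∀ v → Dec (Cocone v S)
    cocone? v = em
    ≢c? : ∀ v → Dec (v ≢ c)
    ≢c? v = em
    D D′ : List V
    D = filter cocone? (nub X)
    D′ = filter ≢c? D
    D! : Unique D
    D! = Unique.filter⁺ cocone? (deduplicate-! _≟ᵥ_ X)
    ∈D : ∀ {v} → Cocone v S → v ∈ D
    ∈D v⊥S = ∈-filter⁺ cocone? (∈-deduplicate⁺ _≟ᵥ_ (all∈X v⊥S)) v⊥S
    smaller : length D′ < length D
    smaller = filter-notAll ≢c? D (Any.map (λ e ≢c → ≢c (sym e)) (∈D c⊥S))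
    covered : ∀ {w} → w ∈ D → w ∈ map F D′
    covered {w} w∈D with preimage surj w
    ... | v , refl = ∈-map⁺ F (∈-filter⁺ ≢c? (∈D v⊥S) v≢c)
      where
      w∈ = ∈-filter⁻ cocone? {xs = nub X} w∈D
      v⊥S : Cocone v S
      v⊥S = All.tabulate λ s∈ →
        (λ { refl → proj₁ (All.lookup (proj₂ w∈) s∈) (F-fixes s∈) })
        , λ a → proj₂ (All.lookup (proj₂ w∈) s∈) (subst (F v ∼_) (F-fixes s∈) (F-hom surj a))
      v≢c : v ≢ c
      v≢c refl = c′∉ (∈-++⁺ʳ S (subst (_∈ X) Fc≡c′ (∈-deduplicate⁻ _≟ᵥ_ X (proj₁ w∈))))

  -- Stable sets, cliques and joins.

  Stable : List V → Set
  Stable X = All (λ x → All (λ y → ¬ (x ∼ y)) X) X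

  Joined Perp : List V → List V → Set
  Joined X Y = All (λ x → Cone x Y) X
  Perp X Y = All (λ x → Cocone x Y) X

  -- Unlike `Stable` lists, these have no repetitions, so their lengths count vertices.
  Independent Clique : List V → Set
  Independent = AllPairs _⊥ᵥ_
  Clique = AllPairs _∼_

  Independent⇒Stable : ∀ {X} → Independent X → Stable X
  Independent⇒Stable {X} ind = all² nonadjacent
    where
    nonadjacent : ∀ {x y} → x ∈ X → y ∈ X → ¬ (x ∼ y)
    nonadjacent x∈ y∈ a with ∈-AllPairs₂ ind x∈ y∈
    ... | inj₁ refl = ∼-irrefl refl a
    ... | inj₂ (inj₁ p) = proj₂ p a
    ... | inj₂ (inj₂ p) = proj₂ p (∼-sym a)

  module _ {R : V → V → Set} {X : List V} where

    ++²⁺ : ∀ {Y Z} → All (λ x → All (R x) Y) X → All (λ x → All (R x) Z) X →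
           All (λ x → All (R x) (Y ++ Z)) X
    ++²⁺ p q = All.zipWith (λ (y , z) → All.++⁺ y z) (p , q)

    ++²⁻ˡ : ∀ Y {Z} → All (λ x → All (R x) (Y ++ Z)) X → All (λ x → All (R x) Y) X
    ++²⁻ˡ Y = All.map (All.++⁻ˡ Y)

    ++²⁻ʳ : ∀ Y {Z} → All (λ x → All (R x) (Y ++ Z)) X → All (λ x → All (R x) Z) X
    ++²⁻ʳ Y = All.map (All.++⁻ʳ Y)

    ⊆² : ∀ {X′ Y Y′} → (∀ {x} → x ∈ X′ → x ∈ X) → (∀ {y} → y ∈ Y′ → y ∈ Y) →
         All (λ x → All (R x) Y) X → All (λ x → All (R x) Y′) X′
    ⊆² X⊆ Y⊆ p = all² λ x∈ y∈ → lookup² p (X⊆ x∈) (Y⊆ y∈)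

    swap² : Symmetric R → ∀ {Y} → All (λ x → All (R x) Y) X → All (λ y → All (R y) X) Y
    swap² R-sym p = all² λ y∈ x∈ → R-sym (lookup² p x∈ y∈)

  Stable-++ : ∀ {X Y} → Stable X → Stable Y → Perp X Y → Stable (X ++ Y)
  Stable-++ sX sY X⊥Y = All.++⁺ (++²⁺ sX (All.map (All.map proj₂) X⊥Y))
                               (++²⁺ (All.map (All.map proj₂) (swap² ⊥-sym X⊥Y)) sY)

  Independent⇒Unique : ∀ {X} → Independent X → Unique X
  Independent⇒Unique = AllPairs.map proj₁

  -- Maps into complete multipartite sets.

  data Match : List (List V) → List (List V) → V → V → Set where
    here : ∀ {Y W Ys Ws} (i : Fin (length Y)) (j : Fin (length W)) → toℕ i ≡ toℕ j →
           Match (Y ∷ Ys) (W ∷ Ws) (lookup Y i) (lookup W j)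
    there : ∀ {Y W Ys Ws x y} → Match Ys Ws x y → Match (Y ∷ Ys) (W ∷ Ws) x y

  Match-∈ : ∀ {Ys Ws x y} → Match Ys Ws x y → y ∈ concat Ws
  Match-∈ {Ws = W ∷ _} (here i j _) = ∈-++⁺ˡ {xs = W} (∈-lookup j)
  Match-∈ {Ws = W ∷ _} (there m) = ∈-++⁺ʳ W (Match-∈ m)

  Match-total : ∀ {Ys Ws} → Pointwise (λ Y W → length Y ≤ length W) Ys Ws →
                ∀ {x} → x ∈ concat Ys → ∃[ y ] Match Ys Ws x y
  Match-total {Y ∷ _} {W ∷ _} (le ∷ les) x∈ with ∈-++⁻ Y x∈
  ... | inj₁ x∈Y = lookup W j , subst (λ z → Match _ _ z (lookup W j)) (sym (lookup-index x∈Y))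
                                  (here (index x∈Y) j (sym (toℕ-fromℕ< lt)))
    where
    lt = ℕ.<-≤-trans (toℕ<n (index x∈Y)) le
    j = fromℕ< lt
  ... | inj₂ x∈Ys with Match-total les x∈Ys
  ... | y , m = y , there m

  Joined-concat : ∀ {X Ws} → All (Joined X) Ws → Joined X (concat Ws)
  Joined-concat {Ws = Ws} js = all² λ x∈ y∈ →
    let W , y∈W , W∈ = ∈-concat⁻′ Ws y∈ in lookup² (All.lookup js W∈) x∈ y∈W

  Joined-concat⁻ : ∀ {X} Ws → Joined X (concat Ws) → All (Joined X) Ws
  Joined-concat⁻ [] _ = []
  Joined-concat⁻ (W ∷ Ws) jn = ++²⁻ˡ W jn ∷ Joined-concat⁻ Ws (++²⁻ʳ W jn)

  -- There are no edges to preserve inside a source class, and any two vertices in different target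
  -- classes are adjacent, hence also distinct.
  Match-faithful : ∀ {Ys Ws} → All Stable Ys → All Unique Ws → AllPairs Joined Ws → Faithful (Match Ys Ws)
  Match-faithful {Y ∷ Ys} {W ∷ Ws} (st ∷ sts) (u ∷ us) (jn ∷ jns) = faithful
    where
    cross : ∀ (j : Fin (length W)) {x y} → Match Ys Ws x y → lookup W j ∼ y
    cross j m = lookup² (Joined-concat jn) (∈-lookup j) (Match-∈ m)
    faithful : Faithful (Match (Y ∷ Ys) (W ∷ Ws))
    faithful (here i j e) (here i′ j′ e′) =
      (λ eq → cong (lookup Y) (toℕ-injective (trans e (trans (cong toℕ (lookup-injective u eq)) (sym e′))))) ,
      λ a → contradiction a (lookup² st (∈-lookup i) (∈-lookup i′))
    faithful (here i j e) (there m) = (λ eq → contradiction eq (∼⇒≢ (cross j m))) , λ _ → cross j m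
    faithful (there m) (here i j e) = (λ eq → contradiction (sym eq) (∼⇒≢ (cross j m))) , λ _ → ∼-sym (cross j m)
    faithful (there m) (there m′) = Match-faithful sts us jns m m′

  -- The main transfer tool: a multipartite set maps monomorphically into every complete
  -- multipartite set with classes at least as large, so a cocone can be pulled back.
  pull-cocone-partite : ∀ {Ys Ws} → Pointwise (λ Y W → length Y ≤ length W) Ys Ws →
    All Stable Ys → All Unique Ws → AllPairs Joined Ws → Coconed (concat Ws) → Coconed (concat Ys)
  pull-cocone-partite le st u jn =
    pull-cocone _ _ (Match _ _) (Match-total le) Match-∈ (Match-faithful st u jn)

  -- Cliques with a cocone.

  CoconedClique : ℕ → Set
  CoconedClique n = ∃[ C ] (Clique C × length C ≡ n × Coconed C)

  []-coconed : Coconed []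
  []-coconed = proj₁ (fresh []) , []

  -- Any bijection onto a clique preserves adjacency. This is the multipartite transfer with
  -- singleton classes.
  CoconedClique⇒Coconed : ∀ {n} → CoconedClique n → ∀ X → length X ≡ n → Coconed X
  CoconedClique⇒Coconed (C , clique , lenC , coc) X lenX =
    subst Coconed (concat-map-[_] X)
      (pull-cocone-partite (pw X C (trans lenX (sym lenC)))
        (All.map⁺ (All.tabulate {xs = X} λ _ → ((∼-irrefl refl) ∷ []) ∷ []))
        (All.map⁺ (All.tabulate {xs = C} λ _ → [] ∷ []))
        (AllPairs.map⁺ (AllPairs.map (λ a → (a ∷ []) ∷ []) clique))
        (subst Coconed (sym (concat-map-[_] C)) coc))
    where
    pw : ∀ X C → length X ≡ length C →
         Pointwise (λ Y W → length Y ≤ length W) (map [_] X) (map [_] C)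
    pw [] [] _ = []
    pw (_ ∷ X) (_ ∷ C) e = s≤s z≤n ∷ pw X C (ℕ.suc-injective e)

  -- An independent set maps monomorphically onto any set of the same size, and the endomorphism
  -- extending this map carries the cone along.
  push-cone : ∀ {S} → Independent S → Coned S → ∀ X → length (nub X) ≡ length S → Coned X
  push-cone {S} ind (d , d∼S) X len = F d , All.tabulate λ x∈ → hits (∈-deduplicate⁺ _≟ᵥ_ x∈)
    where
    M : V → V → Set
    M = Match [ S ] [ nub X ]
    ext = extend (concat [ S ]) M (Match-total (ℕ.≤-reflexive (sym len) ∷ []))
            (Match-faithful (Independent⇒Stable ind ∷ []) (deduplicate-! _≟ᵥ_ X ∷ []) ([] ∷ []))
    F = proj₁ ext
    -- The extension is known only to respect `M`; since `S` has no repetitions, this determines its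
    -- values on `S`.
    functional : ∀ {x y y′} → M x y → M x y′ → y ≡ y′
    functional m m′ = go m m′ refl
      where
      go : ∀ {x x′ y y′} → M x y → M x′ y′ → x ≡ x′ → y ≡ y′
      go (here i j e) (here i′ j′ e′) eq = cong (lookup (nub X)) (toℕ-injective
        (trans (sym e) (trans (cong toℕ (lookup-injective (Independent⇒Unique ind) eq)) e′)))
    hits : ∀ {x} → x ∈ nub X → F d ∼ x
    hits {x} x∈ = subst (F d ∼_) (functional (proj₂ (proj₂ ext) (∈-++⁺ˡ {xs = S} (∈-lookup i))) m)
                    (F-hom (proj₁ (proj₂ ext)) (All.lookup d∼S (∈-lookup i)))
      where
      lt = ℕ.<-≤-trans (toℕ<n (index x∈)) (ℕ.≤-reflexive len)
      i = fromℕ< lt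
      m : M (lookup S i) x
      m = subst (M (lookup S i)) (sym (lookup-index x∈)) (here i (index x∈) (toℕ-fromℕ< lt))

  -- Ramsey's theorem for infinite vertex sets.

  Infinite : (V → Set) → Set
  Infinite P = ∀ X → ∃[ v ] (P v × v ∉ X)

  -- For a vertex v of the set, either infinitely many members are neighbours of v, and v enlarges a
  -- clique found among them, or all but finitely many are not, and v enlarges an independent set.
  ramsey : ∀ k n {P : V → Set} → Infinite P →
    (∃[ C ] (Clique C × length C ≡ k × All P C)) ⊎ (∃[ S ] (Independent S × length S ≡ n × All P S))
  ramsey zero n inf = inj₁ ([] , [] , refl , [])
  ramsey (suc k) zero inf = inj₂ ([] , [] , refl , [])
  ramsey (suc k) (suc n) {P} inf with inf []
  ... | v , Pv , _ with lem (Infinite (λ x → P x × v ∼ x))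
  ... | yes inf∼ with ramsey k (suc n) inf∼
  ...   | inj₁ (C , clique , len , all) = inj₁ (v ∷ C , All.map proj₂ all ∷ clique , cong suc len , Pv ∷ All.map proj₁ all)
  ...   | inj₂ (S , ind , len , all) = inj₂ (S , ind , len , All.map proj₁ all)
  ramsey (suc k) (suc n) {P} inf | v , Pv , _ | no ¬inf∼ with ∃-of-¬∀ em ¬inf∼
  ... | X₀ , none with ramsey (suc k) n {λ x → P x × v ⊥ᵥ x} inf⊥
    where
    inf⊥ : Infinite (λ x → P x × v ⊥ᵥ x)
    inf⊥ X with inf (v ∷ X₀ ++ X)
    ... | x , Px , x∉ = x , (Px , (λ e → x∉ (here (sym e))) ,
                         λ a → none (x , (Px , a) , x∉ ∘ there ∘ ∈-++⁺ˡ)) , x∉ ∘ there ∘ ∈-++⁺ʳ X₀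
  ...   | inj₁ (C , clique , len , all) = inj₁ (C , clique , len , All.map proj₁ all)
  ...   | inj₂ (S , ind , len , all) = inj₂ (v ∷ S , All.map proj₂ all ∷ ind , cong suc len , Pv ∷ All.map proj₁ all)

  -- Graphs in which some finite set has no cocone.

  module _ (A₀ : List V) (uncoconed : ¬ Coconed A₀) where

    -- If all degrees were finite, a vertex outside `A₀` and all neighbourhoods of its members would
    -- be a cocone of `A₀`.
    infinite-degree : ∃[ s ] Infinite (s ∼_)
    infinite-degree with lem (∃[ s ] Infinite (s ∼_))
    ... | yes p = p
    ... | no none = contradiction (v , All.tabulate λ x∈ → ⊥-sym (away x∈)) uncoconed
      where
      bound : ∀ s → ∃[ X ] ¬ (∃[ v ] (s ∼ v × v ∉ X))
      bound s = ∃-of-¬∀ em (λ inf → none (s , inf))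
      bounds : List V → List V
      bounds [] = []
      bounds (s ∷ A) = proj₁ (bound s) ++ bounds A
      v = proj₁ (fresh (A₀ ++ bounds A₀))
      v∉ = proj₂ (fresh (A₀ ++ bounds A₀))
      outside : ∀ {A x} → x ∈ A → v ∉ bounds A → ¬ (x ∼ v)
      outside (here refl) v∉ a = proj₂ (bound _) (v , a , v∉ ∘ ∈-++⁺ˡ)
      outside {s ∷ A} (there x∈) v∉ = outside x∈ (v∉ ∘ ∈-++⁺ʳ (proj₁ (bound s)))
      away : ∀ {x} → x ∈ A₀ → x ⊥ᵥ v
      away x∈ = (λ { refl → v∉ (∈-++⁺ˡ x∈) }) , outside x∈ (v∉ ∘ ∈-++⁺ʳ A₀)

    -- A coconed clique as large as `A₀` would give `A₀` a cocone.
    ∃-maximal-coconed-clique : ∃[ k ] (CoconedClique k × ¬ CoconedClique (suc k))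
    ∃-maximal-coconed-clique = last-success em CoconedClique ([] , [] , refl , []-coconed) (length A₀)
      λ cc → uncoconed (CoconedClique⇒Coconed cc A₀ refl)

    -- Structure forced when the largest coconed cliques have size `suc j`.

    module _ {j : ℕ} (small : CoconedClique (suc j)) (¬big : ¬ CoconedClique (2 + j)) where

      opaque
        -- Ramsey's theorem applies to the infinitely many cocones of `S`; a clique of size `2 + j`
        -- among them would itself have the cocone s.
        independent-cocones : ∀ {S s} → s ∈ S → Coconed S → ∀ n →
          ∃[ I ] (Independent I × length I ≡ n × Perp I S)
        independent-cocones s∈ coc n with ramsey (2 + j) n (cocone-avoiding coc)
        ... | inj₁ (C , clique , len , all) =
                contradiction (C , clique , len , _ , All.map (λ c → ⊥-sym (All.lookup c s∈)) all) ¬big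
        ... | inj₂ p = p

      opaque
        vertex-coconed : ∀ x → Coconed [ x ]
        vertex-coconed x with CoconedClique⇒Coconed small (x ∷ replicate j x) (cong suc (length-replicate j))
        ... | w , w⊥x ∷ _ = w , w⊥x ∷ []

      opaque
        -- Arbitrarily large independent sets have a common cocone c, and a stable set maps
        -- monomorphically into one of them.
        stable-coconed : ∀ {X} → Stable X → Coconed X
        stable-coconed {X} st with fresh []
        ... | c , _ with independent-cocones (here refl) (vertex-coconed c) (length X)
        ... | I , ind , len , I⊥c = subst Coconed (++-identityʳ X)
          (pull-cocone-partite {[ X ]} {[ I ]} (ℕ.≤-reflexive (sym len) ∷ []) (st ∷ [])
            (Independent⇒Unique ind ∷ []) ([] ∷ [])
            (c , subst (Cocone c) (sym (++-identityʳ I)) (All.map (λ p → ⊥-sym (All.lookup p (here refl))) I⊥c)))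

      -- Otherwise v would be a cocone of the clique `d ∷ D`, which exceeds the maximal size. This
      -- is how nonadjacency to a clique forces edges.
      cocone-∼ : ∀ {D d v} → Clique D → length D ≡ suc j → Cone d D → Cocone v D → v ∼ d
      cocone-∼ {c ∷ _} clique len (d∼c ∷ d∼D) (v⊥c ∷ v⊥D) with
        ∼-or-⊥ (λ { refl → proj₂ v⊥c d∼c })
      ... | inj₁ a = a
      ... | inj₂ v⊥d = contradiction (_ , (d∼c ∷ d∼D) ∷ clique , cong suc len , _ , v⊥d ∷ v⊥c ∷ v⊥D) ¬big

      opaque
        -- If a clique of size `2 + j` exists, one of its vertices is adjacent to every cocone of
        -- the rest. If none exists, Ramsey's theorem in an infinite neighbourhood must return an
        -- independent set.
        independent-coned : ∀ n → ∃[ S ] (Independent S × length S ≡ n × Coned S)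
        independent-coned n with lem (∃[ D ] (Clique D × length D ≡ 2 + j))
        ... | yes (d ∷ D , d∼D ∷ clique , len) with ℕ.suc-injective len
        ...   | len′ with independent-cocones (proj₂ (length≡suc⇒∈ len′)) (CoconedClique⇒Coconed small D len′) n
        ...   | S , ind , lenS , S⊥D = S , ind , lenS , d , All.map (λ v⊥D → ∼-sym (cocone-∼ clique len′ d∼D v⊥D)) S⊥D
        independent-coned n | no none with infinite-degree
        ... | s , inf with ramsey (2 + j) n inf
        ...   | inj₁ (C , clique , len , _) = contradiction (C , clique , len) none
        ...   | inj₂ (S , ind , len , all) = S , ind , len , s , all

      opaque
        coned : ∀ X → Coned X
        coned X with independent-coned (length (nub X))
        ... | S , ind , len , cone = push-cone ind cone X (sym len)

      opaque
        clique-joined : ∀ Y n → ∃[ D ] (Clique D × length D ≡ n × Joined D Y)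
        clique-joined Y zero = [] , [] , refl , []
        clique-joined Y (suc n) with clique-joined Y n
        ... | D , clique , len , jn with coned (D ++ Y)
        ... | d , d∼ = d ∷ D , All.++⁻ˡ D d∼ ∷ clique , cong suc len , All.++⁻ʳ D d∼ ∷ jn

      opaque
        -- With `D` a clique of size `suc j` joined to `Y`, each cocone of `D` is adjacent to all of
        -- `Y` by `cocone-∼`.
        independent-joined : ∀ Y n → ∃[ I ] (Independent I × length I ≡ n × Joined I Y)
        independent-joined Y n with clique-joined Y (suc j)
        ... | D , clique , len , D∼Y with independent-cocones (proj₂ (length≡suc⇒∈ len)) (CoconedClique⇒Coconed small D len) n
        ... | I , ind , lenI , I⊥D = I , ind , lenI , all² λ i∈ y∈ →
                cocone-∼ clique len (All.tabulate λ d∈ → ∼-sym (lookup² D∼Y d∈ y∈)) (All.lookup I⊥D i∈)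

      -- Cocones of bipartite sets.

      PartiteSet : ℕ → Set
      PartiteSet r = ∃[ Ys ] (length Ys ≡ r × All Stable Ys)

      PartiteCoconed : ℕ → Set
      PartiteCoconed r = (Y : PartiteSet r) → Coconed (concat (proj₁ Y))

      -- A target for `pull-cocone-partite`: edges inside a side are allowed, as they arise in
      -- `biclique-suc`.
      CoconedBiclique : ℕ → ℕ → Set
      CoconedBiclique m n = ∃[ X ] ∃[ Y ] (Unique X × Unique Y × m ≤ length X × n ≤ length Y
                                           × Joined X Y × Coconed (X ++ Y))

      opaque
        CoconedBiclique⇒Coconed : ∀ {m n X Y} → CoconedBiclique m n → Stable X → Stable Y →
          length X ≤ m → length Y ≤ n → Coconed (X ++ Y)
        CoconedBiclique⇒Coconed {X = X} {Y} (X′ , Y′ , uX , uY , m≤ , n≤ , jn , w , w⊥) sX sY ≤m ≤n =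
          subst (λ Z → Coconed (X ++ Z)) (++-identityʳ Y)
            (pull-cocone-partite {X ∷ Y ∷ []} {X′ ∷ Y′ ∷ []} (ℕ.≤-trans ≤m m≤ ∷ ℕ.≤-trans ≤n n≤ ∷ [])
              (sX ∷ sY ∷ []) (uX ∷ uY ∷ []) ((jn ∷ []) ∷ [] ∷ [])
              (w , subst (λ Z → Cocone w (X′ ++ Z)) (sym (++-identityʳ Y′)) w⊥))

      -- With p a cocone of X ∪ I, x a cone of p ∪ X ∪ I and w a cocone of
      -- x ∪ p ∪ X, half of I is joined to w (and p is a cocone of X ∪ w and that
      -- half) or half of I is joined to x but avoids w (a cocone of X ∪ x and that half).
      biclique-suc : ∀ {m} →
        (∀ {x p X} → Stable (p ∷ X) → length X ≡ m → Coconed (x ∷ p ∷ X)) →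
        (∀ n → CoconedBiclique m n) → ∀ n → CoconedBiclique (suc m) n
      biclique-suc {m} star bicliques n with independent-joined [] (n + n)
      ... | I , indI , lenI , _ with independent-joined I m
      ... | X , indX , lenX , X∼I with CoconedBiclique⇒Coconed (bicliques (n + n))
              (Independent⇒Stable indX) (Independent⇒Stable indI) (ℕ.≤-reflexive lenX) (ℕ.≤-reflexive lenI)
      ... | p , p⊥XI with All.++⁻ˡ X p⊥XI | All.++⁻ʳ X p⊥XI | coned (p ∷ X ++ I)
      ... | p⊥X | p⊥I | x , x∼p ∷ x∼XI with star {x} (Independent⇒Stable (p⊥X ∷ indX)) lenX
      ... | w , w⊥x ∷ w⊥p ∷ w⊥X = split (n ℕ.≤? length I₁)
        where
        w∼? : ∀ i → Dec (w ∼ i)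
        w∼? i = lem (w ∼ i)
        I₁ I₂ : List V
        I₁ = filter w∼? I
        I₂ = filter (¬? ∘ w∼?) I
        ∈I₁ : ∀ {i} → i ∈ I₁ → i ∈ I × w ∼ i
        ∈I₁ = ∈-filter⁻ w∼? {xs = I}
        ∈I₂ : ∀ {i} → i ∈ I₂ → i ∈ I × ¬ (w ∼ i)
        ∈I₂ = ∈-filter⁻ (¬? ∘ w∼?) {xs = I}
        uX = Independent⇒Unique indX
        uI = Independent⇒Unique indI
        x∼I = All.++⁻ʳ X x∼XI
        split : Dec (n ≤ length I₁) → CoconedBiclique (suc m) n
        split (yes n≤) = w ∷ X , I₁ , All.map proj₁ w⊥X ∷ uX , Unique.filter⁺ w∼? uI
          , s≤s (ℕ.≤-reflexive (sym lenX)) , n≤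
          , All.tabulate (proj₂ ∘ ∈I₁) ∷ ⊆² id (proj₁ ∘ ∈I₁) X∼I
          , p , ⊥-sym w⊥p ∷ All.++⁺ p⊥X (All.tabulate (All.lookup p⊥I ∘ proj₁ ∘ ∈I₁))
        split (no n≰) = x ∷ X , I₂ , All.map ∼⇒≢ (All.++⁻ˡ X x∼XI) ∷ uX , Unique.filter⁺ (¬? ∘ w∼?) uI
          , s≤s (ℕ.≤-reflexive (sym lenX))
          , ℕ.+-cancelˡ-≤ n _ _ (ℕ.≤-trans (ℕ.≤-reflexive (trans (sym lenI) (length-filter-∁ w∼? I)))
                                  (ℕ.+-monoˡ-≤ (length I₂) (ℕ.<⇒≤ (ℕ.≰⇒> n≰))))
          , All.tabulate (All.lookup x∼I ∘ proj₁ ∘ ∈I₂) ∷ ⊆² id (proj₁ ∘ ∈I₂) X∼I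
          , w , w⊥x ∷ All.++⁺ w⊥X (All.tabulate λ i∈ →
              (λ { refl → proj₂ w⊥x (∼-sym (All.lookup x∼I (proj₁ (∈I₂ i∈)))) }) , proj₂ (∈I₂ i∈))

      bicliques-coconed : (∀ x y → Coconed (x ∷ y ∷ [])) → ∀ m n → CoconedBiclique m n
      bicliques-coconed edge = bicliques
        where
        empty : ∀ n → CoconedBiclique 0 n
        empty n with independent-joined [] n
        ... | I , ind , len , _ = [] , I , [] , Independent⇒Unique ind , z≤n , ℕ.≤-reflexive (sym len) , []
                                , stable-coconed (Independent⇒Stable ind)
        stars : ∀ n → CoconedBiclique 1 n
        -- For `m = 0` the star to be coconed is a single pair; the resulting bicliques then cocone
        -- the larger stars used below.
        stars = biclique-suc (λ { {X = []} _ _ → edge _ _ }) empty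
        bicliques : ∀ m n → CoconedBiclique m n
        bicliques zero = empty
        bicliques (suc m) = biclique-suc
          (λ {x} {p} {X} st _ → CoconedBiclique⇒Coconed {X = [ x ]} (stars (suc (length X)))
             ((∼-irrefl refl ∷ []) ∷ []) st ℕ.≤-refl ℕ.≤-refl)
          (bicliques m)

      bipartite-coconed : (∀ x y → Coconed (x ∷ y ∷ [])) → PartiteCoconed 2
      bipartite-coconed edge (X ∷ Y ∷ [] , _ , sX ∷ sY ∷ []) = subst (λ Z → Coconed (X ++ Z)) (sym (++-identityʳ Y))
        (CoconedBiclique⇒Coconed (bicliques-coconed edge _ _) sX sY ℕ.≤-refl ℕ.≤-refl)

      -- Cliques of every size exist, and one of size `2 + j` is a partite set with singleton
      -- classes.
      clique-not-partite-coconed : ¬ PartiteCoconed (2 + j)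
      clique-not-partite-coconed coc with clique-joined [] (2 + j)
      ... | D , clique , len , _ = ¬big (D , clique , len , subst Coconed (concat-map-[_] D)
        (coc (map [_] D , trans (length-map [_] D) len , All.map⁺ (All.tabulate λ _ → (∼-irrefl refl ∷ []) ∷ []))))

      -- The blow-up of an induced four-vertex path.

      module _ {m : ℕ} (good : PartiteCoconed (2 + m)) (bad : PartiteSet (3 + m)) (¬coconed : ¬ Coconed (concat (proj₁ bad))) where

        N : ℕ
        N = length (concat (proj₁ bad))

        Big : List V → Set
        Big W = Unique W × N ≤ length W

        -- Classes of size `N` can hold every class of the bad set, so a cocone would pull back to
        -- it.
        big-uncoconed : ∀ {Ws} → length Ws ≡ 3 + m → All Big Ws → AllPairs Joined Ws → ¬ Coconed (concat Ws)
        big-uncoconed {Ws} len big jn coc = ¬coconed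
          (pull-cocone-partite (pw (proj₁ bad) Ws (trans (proj₁ (proj₂ bad)) (sym len)) ℕ.≤-refl big)
            (proj₂ (proj₂ bad)) (All.map proj₁ big) jn coc)
          where
          pw : ∀ Ys Ws → length Ys ≡ length Ws → length (concat Ys) ≤ N → All Big Ws →
               Pointwise (λ Y W → length Y ≤ length W) Ys Ws
          pw [] [] _ _ _ = []
          pw (Y ∷ Ys) (W ∷ Ws) e le (b ∷ bs) rewrite length-++ Y {concat Ys} =
            ℕ.≤-trans (ℕ.m+n≤o⇒m≤o _ le) (proj₂ b) ∷ pw Ys Ws (ℕ.suc-injective e) (ℕ.m+n≤o⇒n≤o (length Y) le) bs

        -- Vertices are added one at a time: those found so far merge with `Y` into one stable
        -- class, so the number of classes stays `2 + m` and `good` applies again.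
        perp-class : ∀ {Y Ys} → length Ys ≡ suc m → Stable Y → All Stable Ys → ∀ A n →
          ∃[ U ] (Independent U × length U ≡ n × Perp U (Y ++ concat Ys) × All (_∉ A) U)
        perp-class len sY sYs A zero = [] , [] , refl , [] , []
        perp-class {Y} {Ys} len sY sYs A (suc n) with perp-class len sY sYs A n
        ... | U , ind , lenU , perp , avoid with cocone-avoiding (good ((U ++ Y) ∷ Ys , cong suc len ,
                Stable-++ (Independent⇒Stable ind) sY (++²⁻ˡ Y perp) ∷ sYs)) A
        ... | u , u⊥ , u∉ = u ∷ U , All.++⁻ˡ U u⊥UY ∷ ind , cong suc lenU
                          , All.++⁺ (All.++⁻ʳ U u⊥UY) (All.++⁻ʳ (U ++ Y) u⊥) ∷ perp , u∉ ∷ avoid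
          where u⊥UY = All.++⁻ˡ (U ++ Y) u⊥

        -- The common neighbours of `U` in `W`, filtered by one vertex at a time so that the losses
        -- can be counted.
        near : List V → List V → List V
        near [] W = W
        near (u ∷ U) W = filter (λ v → lem (u ∼ v)) (near U W)

        near-⊆ : ∀ U {W v} → v ∈ near U W → v ∈ W
        near-⊆ [] v∈ = v∈
        near-⊆ (u ∷ U) {W} v∈ = near-⊆ U (proj₁ (∈-filter⁻ (λ v → lem (u ∼ v)) {xs = near U W} v∈))

        near-joined : ∀ U W → Joined U (near U W)
        near-joined [] W = []
        near-joined (u ∷ U) W = All.all-filter (λ v → lem (u ∼ v)) (near U W)
          ∷ ⊆² id (proj₁ ∘ ∈-filter⁻ (λ v → lem (u ∼ v)) {xs = near U W}) (near-joined U W)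

        near-unique : ∀ U {W} → Unique W → Unique (near U W)
        near-unique [] uW = uW
        near-unique (u ∷ U) uW = Unique.filter⁺ (λ v → lem (u ∼ v)) (near-unique U uW)

        -- Each u in `U` loses fewer than `N` vertices of `W`: otherwise the lost ones and `Ws`
        -- would form a large complete `3 + m`-partite set with cocone u.
        near-length : ∀ {Ws W} → length Ws ≡ 2 + m → All Big Ws → AllPairs Joined Ws →
          Unique W → Joined W (concat Ws) →
          ∀ {U n} → length U ≡ n → Perp U (concat Ws) → All (_∉ W) U → ∀ L → L + n * N ≤ length W → L ≤ length (near U W)
        near-length {Ws} {W} len big jn uW W∼Ws = λ { refl → go }
          where
          go : ∀ {U} → Perp U (concat Ws) → All (_∉ W) U → ∀ L → L + length U * N ≤ length W → L ≤ length (near U W)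
          go [] [] L le = subst (_≤ length W) (ℕ.+-identityʳ L) le
          go {u ∷ U} (u⊥ ∷ perp) (u∉ ∷ avoid) L le = ℕ.+-cancelʳ-≤ N _ _
            (ℕ.≤-trans (go perp avoid (L + N) (subst (_≤ length W) (sym (ℕ.+-assoc L N _)) le))
              (ℕ.≤-trans (ℕ.≤-reflexive (length-filter-∁ u∼? (near U W)))
                (ℕ.+-monoʳ-≤ (length (filter u∼? (near U W))) (ℕ.<⇒≤ (ℕ.≰⇒> few)))))
            where
            u∼? : ∀ v → Dec (u ∼ v)
            u∼? v = lem (u ∼ v)
            B = filter (¬? ∘ u∼?) (near U W)
            ∈B : ∀ {v} → v ∈ B → v ∈ W × ¬ (u ∼ v)
            ∈B v∈ with ∈-filter⁻ (¬? ∘ u∼?) {xs = near U W} v∈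
            ... | v∈near , ¬a = near-⊆ U v∈near , ¬a
            few : ¬ (N ≤ length B)
            few N≤ = big-uncoconed {B ∷ Ws} (cong suc len) ((Unique.filter⁺ (¬? ∘ u∼?) (near-unique U uW) , N≤) ∷ big)
              (Joined-concat⁻ Ws (⊆² (proj₁ ∘ ∈B) id W∼Ws) ∷ jn)
              (u , All.++⁺ (All.tabulate λ v∈ → (λ { refl → u∉ (proj₁ (∈B v∈)) }) , proj₂ (∈B v∈)) u⊥)

        independents-joined : ∀ Y m n → ∃[ Ws ] (length Ws ≡ m × All (λ W → Independent W × length W ≡ n) Ws
                                              × AllPairs Joined Ws × Joined (concat Ws) Y)
        independents-joined Y zero n = [] , refl , [] , [] , []
        independents-joined Y (suc m) n with independents-joined Y m n
        ... | Ws , len , all , jn , Ws∼Y with independent-joined (concat Ws ++ Y) n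
        ... | W , ind , lenW , W∼ = W ∷ Ws , cong suc len , (ind , lenW) ∷ all
            , Joined-concat⁻ Ws (++²⁻ˡ (concat Ws) W∼) ∷ jn , All.++⁺ (++²⁻ʳ (concat Ws) W∼) Ws∼Y

        -- The path is A, B, C, D in this order. The inner classes get the adjustable size because
        -- they are thinned once more in `¬good`.
        record BlownUpP₄ (L : ℕ) : Set where
          field
            {A B C D} : List V
            A-ind : Independent A
            B-ind : Independent B
            C-ind : Independent C
            D-ind : Independent D
            A-size : length A ≡ N
            D-size : length D ≡ N
            B-size : L ≤ length B
            C-size : L ≤ length C
            A∼B : Joined A B
            B∼C : Joined B C
            C∼D : Joined C D
            A⊥C : Perp A C
            B⊥D : Perp B D
            A⊥D : Perp A D

        near-independent : ∀ U {W} → Independent W → Independent (near U W)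
        near-independent [] ind = ind
        near-independent (u ∷ U) ind = AllPairs.filter⁺ (λ v → lem (u ∼ v)) (near-independent U ind)

        independent-big : ∀ {n} → N ≤ n → ∀ {W} → Independent W × length W ≡ n → Big W
        independent-big N≤n (ind , refl) = Independent⇒Unique ind , N≤n

        -- A is chosen perpendicular to C, Q and Qs, hence joined to most of B;
        -- then D perpendicular to B, Q and Qs, hence joined to most of C.
        blownUpP₄ : ∀ L → N ≤ L → BlownUpP₄ L
        blownUpP₄ L N≤L with independents-joined [] m N
        ... | Qs , lenQs , indQs , jnQs , _ with independent-joined (concat Qs) N
        -- The surplus `N * N` pays for the thinning by `N` vertices, each costing at most `N`.
        ... | Q , indQ , lenQ , Q∼Qs with independent-joined (Q ++ concat Qs) (L + N * N)
        ... | C , indC , lenC , C∼Q with independent-joined (C ++ Q ++ concat Qs) (L + N * N)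
        ... | B , indB , lenB , B∼CQ with perp-class {C} {Q ∷ Qs} (cong suc lenQs) (Independent⇒Stable indC)
                (Independent⇒Stable indQ ∷ All.map (Independent⇒Stable ∘ proj₁) indQs) B N
        ... | A , indA , lenA , A⊥CQ , A∉B with perp-class {near A B} {(A ++ Q) ∷ Qs} (cong suc lenQs)
                (Independent⇒Stable (near-independent A indB))
                (Stable-++ (Independent⇒Stable indA) (Independent⇒Stable indQ) (++²⁻ˡ Q (++²⁻ʳ C A⊥CQ))
                  ∷ All.map (Independent⇒Stable ∘ proj₁) indQs) C N
        ... | D , indD , lenD , D⊥BAQ , D∉C = record
          { A-ind = indA ; B-ind = near-independent A indB ; C-ind = near-independent D indC ; D-ind = indD
          ; A-size = lenA ; D-size = lenD ; B-size = B-large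
          ; C-size = near-length (cong (2 +_) lenQs)
              ((near-unique A (Independent⇒Unique indB) , ℕ.≤-trans N≤L B-large) ∷ bigQs)
              (Joined-concat⁻ (Q ∷ Qs) (⊆² (near-⊆ A) id (++²⁻ʳ C B∼CQ)) ∷ jnQQs)
              (Independent⇒Unique indC)
              (++²⁺ (⊆² id (near-⊆ A) (swap² ∼-sym (++²⁻ˡ C B∼CQ))) C∼Q)
              lenD
              (++²⁺ (++²⁻ˡ (near A B) D⊥BAQ)
                (++²⁺ (++²⁻ʳ A (++²⁻ˡ (A ++ Q) (++²⁻ʳ (near A B) D⊥BAQ)))
                      (++²⁻ʳ (A ++ Q) (++²⁻ʳ (near A B) D⊥BAQ))))
              D∉C L (ℕ.≤-reflexive (sym lenC))
          ; A∼B = near-joined A B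
          ; B∼C = ⊆² (near-⊆ A) (near-⊆ D) (++²⁻ˡ C B∼CQ)
          ; C∼D = swap² ∼-sym (near-joined D C)
          ; A⊥C = ⊆² id (near-⊆ D) (++²⁻ˡ C A⊥CQ)
          ; B⊥D = swap² ⊥-sym (++²⁻ˡ (near A B) D⊥BAQ)
          ; A⊥D = swap² ⊥-sym (++²⁻ˡ A (++²⁻ˡ (A ++ Q) (++²⁻ʳ (near A B) D⊥BAQ)))
          }
          where
          bigQs : All Big (Q ∷ Qs)
          bigQs = All.map (independent-big ℕ.≤-refl) ((indQ , lenQ) ∷ indQs)
          jnQQs : AllPairs Joined (Q ∷ Qs)
          jnQQs = Joined-concat⁻ Qs Q∼Qs ∷ jnQs
          B-large : L ≤ length (near A B)
          B-large = near-length (cong (2 +_) lenQs)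
            (independent-big (ℕ.≤-trans N≤L (ℕ.m≤m+n L _)) (indC , lenC) ∷ bigQs)
            (Joined-concat⁻ (Q ∷ Qs) C∼Q ∷ jnQQs) (Independent⇒Unique indB) B∼CQ lenA A⊥CQ A∉B
            L (ℕ.≤-reflexive (sym lenB))

        concat-map-near-⊆ : ∀ U Ws {v} → v ∈ concat (map (near U) Ws) → v ∈ concat Ws
        concat-map-near-⊆ U (W ∷ Ws) v∈ with ∈-++⁻ (near U W) v∈
        ... | inj₁ v∈W = ∈-++⁺ˡ (near-⊆ U v∈W)
        ... | inj₂ v∈Ws = ∈-++⁺ʳ W (concat-map-near-⊆ U Ws v∈Ws)

        near-joined-concat : ∀ U Ws → Joined U (concat (map (near U) Ws))
        near-joined-concat U [] = All.tabulate λ _ → []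
        near-joined-concat U (W ∷ Ws) = ++²⁺ (near-joined U W) (near-joined-concat U Ws)

        -- With Z and T joined to the pattern, a cocone a of A, B, C, D and Z, and
        -- U perpendicular to a, A, D and T: U is joined to most of B, C and each
        -- class of Z, so a is a cocone of a large complete (3 + m)-partite set.
        ¬good : ⊥
        ¬good with blownUpP₄ (N + N * N) (ℕ.m≤m+n N _)
        ... | P with independents-joined ((A ++ B) ++ (C ++ D)) m (N + N * N)
          where open BlownUpP₄ P
        ... | Z , lenZ , indZ , jnZ , Z∼P
            with independents-joined (concat Z ++ ((A ++ B) ++ (C ++ D))) (suc m) N
          where open BlownUpP₄ P
        -- The path is bipartite, so its blow-up and the `m` classes of `Z` make `2 + m` stable
        -- classes.
        ... | T , lenT , indT , jnT , T∼ZP with good ((A ++ C) ∷ (D ++ B) ∷ Z , cong (2 +_) lenZ ,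
                Stable-++ (Independent⇒Stable A-ind) (Independent⇒Stable C-ind) A⊥C
                ∷ Stable-++ (Independent⇒Stable D-ind) (Independent⇒Stable B-ind) (swap² ⊥-sym B⊥D)
                ∷ All.map (Independent⇒Stable ∘ proj₁) indZ)
          where open BlownUpP₄ P
        -- The vertex a, `A` and `D` together are stable and count as one class beside the `suc m`
        -- classes of `T`.
        ... | a , a⊥ with perp-class {a ∷ A ++ D} {T} lenT
                (Independent⇒Stable (All.++⁺ (All.++⁻ˡ A (All.++⁻ˡ (A ++ C) a⊥))
                                             (All.++⁻ˡ D (All.++⁻ˡ (D ++ B) (All.++⁻ʳ (A ++ C) a⊥)))
                  ∷ AllPairs.++⁺ A-ind D-ind A⊥D))
                (All.map (Independent⇒Stable ∘ proj₁) indT) (B ++ C ++ concat Z) N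
          where open BlownUpP₄ P
        ... | U , indU , lenU , U⊥ , U∉ = big-uncoconed {U ∷ near U B ∷ near U C ∷ map (near U) Z}
              (cong (3 +_) (trans (length-map (near U) Z) lenZ))
              (independent-big ℕ.≤-refl (indU , lenU)
                ∷ (near-unique U (Independent⇒Unique B-ind) , near-A B-ind B-size B∼A B∼T (All.map (_∘ ∈-++⁺ˡ) U∉))
                ∷ (near-unique U (Independent⇒Unique C-ind) , C-large)
                ∷ All.map⁺ (All.tabulate λ W∈ → near-unique U (Independent⇒Unique (proj₁ (All.lookup indZ W∈)))
                    , near-A (proj₁ (All.lookup indZ W∈)) (ℕ.≤-reflexive (sym (proj₂ (All.lookup indZ W∈))))
                        (⊆² (λ w∈ → ∈-concat⁺′ w∈ W∈) id (++²⁻ˡ A (++²⁻ˡ (A ++ B) Z∼P)))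
                        (⊆² (λ w∈ → ∈-concat⁺′ w∈ W∈) id Z∼T)
                        (All.map (λ u∉ v∈ → u∉ (∈-++⁺ʳ B (∈-++⁺ʳ C (∈-concat⁺′ v∈ W∈)))) U∉)))
              (Joined-concat⁻ (near U B ∷ near U C ∷ map (near U) Z)
                  (++²⁺ (near-joined U B) (++²⁺ (near-joined U C) (near-joined-concat U Z)))
                ∷ Joined-concat⁻ (near U C ∷ map (near U) Z)
                    (++²⁺ (⊆² (near-⊆ U) (near-⊆ U) B∼C)
                          (⊆² (near-⊆ U) (concat-map-near-⊆ U Z) (swap² ∼-sym (++²⁻ʳ A (++²⁻ˡ (A ++ B) Z∼P)))))
                ∷ Joined-concat⁻ (map (near U) Z)
                    (⊆² (near-⊆ U) (concat-map-near-⊆ U Z) (swap² ∼-sym (++²⁻ˡ C (++²⁻ʳ (A ++ B) Z∼P))))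
                ∷ AllPairs.map⁺ (AllPairs.map (⊆² (near-⊆ U) (near-⊆ U)) jnZ))
              (a , All.++⁺ (All.map (λ p → ⊥-sym (All.lookup p (here refl))) U⊥)
                  (All.++⁺ (All.tabulate λ v∈ → All.lookup a⊥B (near-⊆ U v∈))
                  (All.++⁺ (All.tabulate λ v∈ → All.lookup a⊥C (near-⊆ U v∈))
                           (All.tabulate λ v∈ → All.lookup a⊥Z (concat-map-near-⊆ U Z v∈)))))
          where
          open BlownUpP₄ P
          a⊥B = All.++⁻ʳ D (All.++⁻ˡ (D ++ B) (All.++⁻ʳ (A ++ C) a⊥))
          a⊥C = All.++⁻ʳ A (All.++⁻ˡ (A ++ C) a⊥)
          a⊥Z = All.++⁻ʳ (D ++ B) (All.++⁻ʳ (A ++ C) a⊥)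
          T∼P = ++²⁻ʳ (concat Z) T∼ZP
          Z∼T : Joined (concat Z) (concat T)
          Z∼T = swap² ∼-sym (++²⁻ˡ (concat Z) T∼ZP)
          A∼T : Joined A (concat T)
          A∼T = swap² ∼-sym (++²⁻ˡ A (++²⁻ˡ (A ++ B) T∼P))
          B∼T : Joined B (concat T)
          B∼T = swap² ∼-sym (++²⁻ʳ A (++²⁻ˡ (A ++ B) T∼P))
          C∼T : Joined C (concat T)
          C∼T = swap² ∼-sym (++²⁻ˡ C (++²⁻ʳ (A ++ B) T∼P))
          D∼T : Joined D (concat T)
          D∼T = swap² ∼-sym (++²⁻ʳ C (++²⁻ʳ (A ++ B) T∼P))
          B∼A = swap² ∼-sym A∼B
          bigT : All Big T
          bigT = All.map (independent-big ℕ.≤-refl) indT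
          U⊥AD : Perp U (A ++ D)
          U⊥AD = ++²⁻ʳ [ a ] (++²⁻ˡ (a ∷ A ++ D) U⊥)
          U⊥T : Perp U (concat T)
          U⊥T = ++²⁻ʳ (a ∷ A ++ D) U⊥
          near-A : ∀ {W} → Independent W → N + N * N ≤ length W → Joined W A → Joined W (concat T) →
                   All (_∉ W) U → N ≤ length (near U W)
          near-A ind size W∼A W∼T avoid = near-length (cong suc lenT)
            (independent-big ℕ.≤-refl (A-ind , A-size) ∷ bigT) (Joined-concat⁻ T A∼T ∷ jnT)
            (Independent⇒Unique ind) (++²⁺ W∼A W∼T) lenU (++²⁺ (++²⁻ˡ A U⊥AD) U⊥T) avoid N size
          -- `C` is joined to `D` and not to `A`, so here `D` completes `T` to `2 + m` classes.
          C-large : N ≤ length (near U C)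
          C-large = near-length (cong suc lenT)
            (independent-big ℕ.≤-refl (D-ind , D-size) ∷ bigT) (Joined-concat⁻ T D∼T ∷ jnT)
            (Independent⇒Unique C-ind) (++²⁺ C∼D C∼T) lenU (++²⁺ (++²⁻ʳ A U⊥AD) U⊥T)
            (All.map (λ u∉ v∈ → u∉ (∈-++⁺ʳ B (∈-++⁺ˡ v∈))) U∉) N C-size

      -- Bipartite sets would then have cocones while some `2 + j`-partite set has none; at the last
      -- success in between, `¬good` gives a contradiction.
      edge-uncoconed : ¬ (∀ x y → Coconed (x ∷ y ∷ []))
      edge-uncoconed edge with last-success em (λ i → PartiteCoconed (2 + i)) (bipartite-coconed edge) j clique-not-partite-coconed
      ... | m , good , ¬next with ∃-of-¬∀ em ¬next
      ... | bad , ¬coconed = ¬good good bad ¬coconed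

  -- Partial homomorphisms and the back-and-forth steps.

  Compatible : V × V → V × V → Set
  Compatible (a , b) (a′ , b′) = (a ≡ a′ → b ≡ b′) × (a ∼ a′ → b ∼ b′)

  PartialHom : List (V × V) → Set
  PartialHom L = All (λ p → All (Compatible p) L) L

  insert : ∀ {L v w} → PartialHom L → v ∉ map proj₁ L → (∀ {a b} → (a , b) ∈ L → a ∼ v → b ∼ w) →
           PartialHom ((v , w) ∷ L)
  insert hom v∉ w∼ =
    (((λ _ → refl) , λ a → contradiction a (∼-irrefl refl)) ∷
      All.tabulate λ p∈ → (λ { refl → contradiction (∈-map⁺ proj₁ p∈) v∉ }) , ∼-sym ∘ w∼ p∈ ∘ ∼-sym)
    ∷ All.zipWith (λ (c , cs) → c ∷ cs)
        (All.tabulate (λ p∈ → (λ { refl → contradiction (∈-map⁺ proj₁ p∈) v∉ }) , w∼ p∈) , hom)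

  -- The argument splits on the maximal size k of a coconed clique. For k = 0, any image would be a
  -- coconed clique of size 1, so `A` is empty. For k = 1, an edge in `A` would map to an edge with
  -- cocone w, so `A` is stable. The case k ≥ 2 cannot occur.
  preimages-coconed : ∀ {L} → PartialHom L → ∀ {w} A → All (λ a → ∃[ b ] ((a , b) ∈ L × w ⊥ᵥ b)) A → Coconed A
  preimages-coconed hom {w} A A→w⊥ with lem (Coconed A)
  ... | yes coc = coc
  ... | no ¬coc = by-clique-size (∃-maximal-coconed-clique A ¬coc) A→w⊥
    where
    by-clique-size : ∃[ k ] (CoconedClique k × ¬ CoconedClique (suc k)) →
      All (λ a → ∃[ b ] ((a , b) ∈ _ × w ⊥ᵥ b)) A → Coconed A
    by-clique-size (zero , _ , ¬big) [] = []-coconed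
    by-clique-size (zero , _ , ¬big) ((b , _ , w⊥b) ∷ _) =
      contradiction ([ b ] , [] ∷ [] , refl , w , w⊥b ∷ []) ¬big
    by-clique-size (suc zero , small , ¬big) A→w⊥ = stable-coconed A ¬coc small ¬big (all² stable)
      where
      stable : ∀ {a a′} → a ∈ A → a′ ∈ A → ¬ (a ∼ a′)
      stable a∈ a′∈ a∼a′ with All.lookup A→w⊥ a∈ | All.lookup A→w⊥ a′∈
      ... | b , ab∈ , w⊥b | b′ , ab′∈ , w⊥b′ =
        ¬big (b ∷ b′ ∷ [] , (proj₂ (lookup² hom ab∈ ab′∈) a∼a′ ∷ []) ∷ [] ∷ [] , refl , w , w⊥b ∷ w⊥b′ ∷ [])
    by-clique-size (suc (suc i) , small , ¬big) _ = contradiction edge (edge-uncoconed A ¬coc small ¬big)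
      where
      edge : ∀ x y → Coconed (x ∷ y ∷ [])
      edge x y with CoconedClique⇒Coconed small (x ∷ y ∷ replicate i x) (cong (2 +_) (length-replicate i))
      ... | v , v⊥x ∷ v⊥y ∷ _ = v , v⊥x ∷ v⊥y ∷ []

  -- The neighbours of v in the domain are replaced by one representative per image,
  -- on which the partial homomorphism is a monomorphism.
  forth : ∀ {L} → PartialHom L → ∀ v → ∃[ w ] (∀ {a b} → (a , b) ∈ L → a ∼ v → b ∼ w)
  forth {L} hom v = F v , λ ab∈ a∼v →
    subst (_∼ F v) (F-rep ab∈ a∼v) (F-hom (proj₁ (proj₂ ext)) (proj₂ (rep-spec ab∈ a∼v)))
    where
    rep : V → V
    rep b with lem (∃[ a ] ((a , b) ∈ L × a ∼ v))
    ... | yes (a , _) = a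
    -- A default value, excluded by `rep-spec` for images of neighbours of v.
    ... | no _ = b
    rep-spec : ∀ {a b} → (a , b) ∈ L → a ∼ v → (rep b , b) ∈ L × rep b ∼ v
    rep-spec {a} {b} ab∈ a∼v with lem (∃[ a ] ((a , b) ∈ L × a ∼ v))
    ... | yes (_ , p) = p
    ... | no none = contradiction (a , ab∈ , a∼v) none
    ∼v? : ∀ p → Dec (proj₁ p ∼ v)
    ∼v? p = lem (proj₁ p ∼ v)
    Q : List V
    Q = map (rep ∘ proj₂) (filter ∼v? L)
    M : V → V → Set
    M q b = (q , b) ∈ L × q ≡ rep b
    total : ∀ {q} → q ∈ Q → ∃[ b ] M q b
    total q∈ with ∈-map∘filter⁻ (rep ∘ proj₂) ∼v? {xs = L} q∈
    ... | (a , b) , ab∈ , refl , a∼v = b , proj₁ (rep-spec ab∈ a∼v) , refl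
    faithful : Faithful M
    faithful (qb∈ , refl) (q′b′∈ , refl) = cong rep , proj₂ (lookup² hom qb∈ q′b′∈)
    ext = extend Q M total faithful
    F = proj₁ ext
    F-rep : ∀ {a b} → (a , b) ∈ L → a ∼ v → F (rep b) ≡ b
    F-rep {a} {b} ab∈ a∼v = proj₁ (lookup² hom
      (proj₁ (proj₂ (proj₂ ext) (∈-map∘filter⁺ (rep ∘ proj₂) ∼v? ((a , b) , ab∈ , refl , a∼v))))
      (proj₁ (rep-spec ab∈ a∼v))) refl

  -- A cocone of the points whose images are not adjacent to w can be sent to w; taking it outside
  -- the domain keeps the map single-valued.
  back : ∀ {L} → PartialHom L → ∀ {w} → w ∉ map proj₂ L →
         ∃[ v ] (v ∉ map proj₁ L × (∀ {a b} → (a , b) ∈ L → a ∼ v → b ∼ w))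
  back {L} hom {w} w∉ = v , v∉ , adjacent
    where
    w⊥? : ∀ p → Dec (w ⊥ᵥ proj₂ p)
    w⊥? p = lem (w ⊥ᵥ proj₂ p)
    A : List V
    A = map proj₁ (filter w⊥? L)
    A-perp : ∀ {a} → a ∈ A → ∃[ b ] ((a , b) ∈ L × w ⊥ᵥ b)
    A-perp a∈ with ∈-map∘filter⁻ proj₁ w⊥? {xs = L} a∈
    ... | (a , b) , ab∈ , refl , w⊥b = b , ab∈ , w⊥b
    v-data : ∃[ v ] (Cocone v A × v ∉ map proj₁ L)
    v-data = cocone-avoiding (preimages-coconed hom A (All.tabulate A-perp)) (map proj₁ L)
    v : V
    v = proj₁ v-data
    v∉ : v ∉ map proj₁ L
    v∉ = proj₂ (proj₂ v-data)
    adjacent : ∀ {a b} → (a , b) ∈ L → a ∼ v → b ∼ w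
    adjacent {a} {b} ab∈ a∼v with ∼-or-⊥ {w} {b} (λ { refl → w∉ (∈-map⁺ proj₂ ab∈) })
    ... | inj₁ w∼b = ∼-sym w∼b
    ... | inj₂ w⊥b = contradiction (∼-sym a∼v)
      (proj₂ (All.lookup (proj₁ (proj₂ v-data)) (∈-map∘filter⁺ proj₁ w⊥? ((a , b) , ab∈ , refl , w⊥b))))

  Extends : List (V × V) → List (V × V) → Set
  Extends L′ L = All (_∈ L′) L

  Extends-trans : ∀ {L L′ L″} → Extends L″ L′ → Extends L′ L → Extends L″ L
  Extends-trans e e′ = All.map (All.lookup e) e′

  Extends-refl : ∀ L → Extends L L
  Extends-refl L = All.tabulate id

  cover-domain : ∀ {L} → PartialHom L → ∀ v → ∃[ L′ ] (PartialHom L′ × Extends L′ L × ∃[ w ] (v , w) ∈ L′)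
  cover-domain {L} hom v with lem (v ∈ map proj₁ L)
  ... | yes v∈ with ∈-map⁻ proj₁ v∈
  ...   | (_ , w) , vw∈ , refl = L , hom , Extends-refl L , w , vw∈
  cover-domain {L} hom v | no v∉ =
    let w , w∼ = forth hom v in
    (v , w) ∷ L , insert hom v∉ w∼ , All.tabulate there , w , here refl

  cover-range : ∀ {L} → PartialHom L → ∀ w → ∃[ L′ ] (PartialHom L′ × Extends L′ L × ∃[ v ] (v , w) ∈ L′)
  cover-range {L} hom w with lem (w ∈ map proj₂ L)
  ... | yes w∈ with ∈-map⁻ proj₂ w∈
  ...   | (v , _) , vw∈ , refl = L , hom , Extends-refl L , v , vw∈
  cover-range {L} hom w | no w∉ =
    let v , v∉ , w∼ = back hom w∉ in
    (v , w) ∷ L , insert hom v∉ w∼ , All.tabulate there , v , here refl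

  cover : ∀ {L} → PartialHom L → ∀ v →
    ∃[ L′ ] (PartialHom L′ × Extends L′ L × (∃[ w ] (v , w) ∈ L′ × ∃[ u ] (u , v) ∈ L′))
  cover hom v =
    let L₁ , hom₁ , ext₁ , w , vw∈ = cover-domain hom v
        L₂ , hom₂ , ext₂ , u , uv∈ = cover-range hom₁ v
    in L₂ , hom₂ , Extends-trans ext₂ ext₁ , w , All.lookup ext₂ vw∈ , u , uv∈

  -- The limit of the back-and-forth construction.

  module _ (L₀ : List (V × V)) (hom₀ : PartialHom L₀) where

    stage : ℕ → Σ (List (V × V)) PartialHom
    stage zero = L₀ , hom₀
    stage (suc n) = let L , hom , _ = cover (proj₂ (stage n)) (enum n) in L , hom

    Stage : ℕ → List (V × V)
    Stage n = proj₁ (stage n)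

    covered : ∀ n → Extends (Stage (suc n)) (Stage n) ×
      (∃[ w ] (enum n , w) ∈ Stage (suc n) × ∃[ u ] (u , enum n) ∈ Stage (suc n))
    covered n = proj₂ (proj₂ (cover (proj₂ (stage n)) (enum n)))

    Stage-mono : ∀ {m n} → m ≤′ n → Extends (Stage n) (Stage m)
    Stage-mono ≤′-refl = Extends-refl _
    Stage-mono (≤′-step le) = Extends-trans (proj₁ (covered _)) (Stage-mono le)

    -- Both pairs survive into the later of the two stages.
    compatible : ∀ {m n p q} → p ∈ Stage m → q ∈ Stage n → Compatible p q
    compatible {m} {n} p∈ q∈ = lookup² (proj₂ (stage (m ⊔ n)))
      (All.lookup (Stage-mono (ℕ.≤⇒≤′ (ℕ.m≤m⊔n m n))) p∈) (All.lookup (Stage-mono (ℕ.≤⇒≤′ (ℕ.m≤n⊔m m n))) q∈)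

    position : V → ℕ
    position v = proj₁ (enum-surjective v)

    enum-position : ∀ v → enum (position v) ≡ v
    enum-position v = proj₂ (enum-surjective v) refl

    limit : V → V
    limit v = proj₁ (proj₂ (covered (position v)))

    limit-∈ : ∀ v → (v , limit v) ∈ Stage (suc (position v))
    limit-∈ v = subst (λ u → (u , limit v) ∈ Stage (suc (position v))) (enum-position v)
      (proj₁ (proj₂ (proj₂ (covered (position v)))))

    limit-≡ : ∀ {n v w} → (v , w) ∈ Stage n → limit v ≡ w
    limit-≡ {n} {v} vw∈ = proj₁ (compatible {suc (position v)} {n} (limit-∈ v) vw∈) refl

    limit-surjective : IsSurjectiveEndomorphism G limit
    limit-surjective = record { cong = λ {x} {y} →
        proj₂ (compatible {suc (position x)} {suc (position y)} (limit-∈ x) (limit-∈ y)) } , λ w →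
      let u , uw∈ = proj₂ (proj₂ (proj₂ (covered (position w)))) in
      u , λ { refl → trans (limit-≡ {suc (position w)} uw∈) (enum-position w) }

  he-homogeneous : HE-Homogeneous G
  he-homogeneous A B f f-hom = limit L₀ hom₀ , limit-surjective L₀ hom₀ , λ i → limit-≡ L₀ hom₀ {0} (∈-tabulate⁺ i)
    where
    open FiniteInducedSubgraph using (embed; enumeration)
    L₀ : List (V × V)
    L₀ = tabulate λ i → embed A i , embed B (f i)
    compatible₀ : ∀ {p q} → p ∈ L₀ → q ∈ L₀ → Compatible p q
    compatible₀ p∈ q∈ with ∈-tabulate⁻ p∈ | ∈-tabulate⁻ q∈
    ... | i , refl | j , refl =
      -- The repetition-free enumeration of the domain makes the initial list of pairs
      -- single-valued.
      (λ e → cong (embed B ∘ f) (Injection.injective (enumeration A) e)) , IsRelHomomorphism.cong f-hom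
    hom₀ : PartialHom L₀
    hom₀ = all² compatible₀

theorem7p3 : ExcludedMiddle 0ℓ → (G : Graph) → CountablyInfinite G → ME-Homogeneous G ⇔ HE-Homogeneous G
theorem7p3 em G count = mk⇔ (MEGraph.he-homogeneous em G count) (λ he A B f mono → he A B f (proj₁ mono))
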